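{- Let $t\geqslant 2$ be an integer, let $r\in\{2t,2t+1\}$, and put $\ell^*=5$ if $r=2t$ and $\ell^*=7$ if $r=2t+1$. Then for every $n\geqslant 2r-1$, $$I(n,2r-1,r)\geqslant 2\binom{2t-3}{t}+\ell^*\binom{2t-2}{t-1}.$$ Moreover, for every $n\geqslant 2r$, $$N(n,2r-1,r)=I(n,2r-1,r)\geqslant N(n,2r,r),$$ and $$N(n,2r-1,r)\geqslant 2\binom{2t-3}{t}+\ell^*\binom{2t-2}{t-1}.$$
   Context: $\mathrm{Sym}_n$ denotes the symmetric group of permutations of $[n]=\{1,\dots,n\}$. The Hamming distance between $\pi,\tau\in\mathrm{Sym}_n$ is $d(\pi,\tau)=|\{i\in[n]:\pi(i)\neq\tau(i)\}|$. For $\pi\in\mathrm{Sym}_n$ and an integer $r$, $B_r(\pi)=\{\tau\in\mathrm{Sym}_n: d(\pi,\tau)\leqslant r\}$. For integers $d,r$: $I(n,d,r)=\max\{|B_r(\pi)\cap B_r(\tau)| : \pi,\tau\in\mathrm{Sym}_n,\ d(\pi,\tau)=d\}$ and $N(n,d,r)=\max\{|B_r(\pi)\cap B_r(\tau)| : \pi,\tau\in\mathrm{Sym}_n,\ d(\pi,\tau)\geqslant d\}$. Binomial coefficients $\binom{p}{q}$ are $0$ when $q<0$, $p<0$ or $q>p$, and $\binom{0}{0}=1$. -}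

module Defs where

open import Data.Nat using (ℕ; zero; suc; _≤_; _≤?_; _⊔_)
open import Data.Nat.Properties using () renaming (_≟_ to _≟ℕ_)
open import Data.Fin using (Fin)
open import Data.Fin.Properties using (_≟_)
open import Data.Vec using (Vec; []; _∷_; toList; lookup)
open import Data.List using (List; [_]; map; concatMap; filter; length; allFin; foldr; cartesianProduct)
open import Data.Product using (_×_; _,_)
open import Relation.Nullary using (¬?)
open import Relation.Nullary.Decidable using (_×-dec_)
import Data.List.Relation.Unary.Unique.DecPropositional as UDec

-- A permutation of [n] is represented by its table of values
-- (π(1),…,π(n)) : Vec (Fin n) n; it is a permutation iff the entries are distinct.
allVecs : (n k : ℕ) → List (Vec (Fin n) k)
allVecs n zero = [ [] ]
allVecs n (suc k) = concatMap (λ i → map (i ∷_) (allVecs n k)) (allFin n)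

Sym : (n : ℕ) → List (Vec (Fin n) n)
Sym n = filter (λ v → UDec.unique? (_≟_ {n}) (toList v)) (allVecs n n)

hamming : {n : ℕ} → Vec (Fin n) n → Vec (Fin n) n → ℕ
hamming {n} π τ = length (filter (λ i → ¬? (lookup π i ≟ lookup τ i)) (allFin n))

ballInter : (n : ℕ) → ℕ → Vec (Fin n) n → Vec (Fin n) n → ℕ
ballInter n r π τ =
  length (filter (λ σ → (hamming π σ ≤? r) ×-dec (hamming τ σ ≤? r)) (Sym n))

maxList : List ℕ → ℕ
maxList = foldr _⊔_ 0

pairs : (n : ℕ) → List (Vec (Fin n) n × Vec (Fin n) n)
pairs n = cartesianProduct (Sym n) (Sym n)

-- I(n,d,r) = max { |B_r(π) ∩ B_r(τ)| : d(π,τ) = d }   (0 if no such pair)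
I : ℕ → ℕ → ℕ → ℕ
I n d r = maxList (map (λ p → ballInter n r (Data.Product.proj₁ p) (Data.Product.proj₂ p))
  (filter (λ p → hamming (Data.Product.proj₁ p) (Data.Product.proj₂ p) ≟ℕ d) (pairs n)))

-- N(n,d,r) = max { |B_r(π) ∩ B_r(τ)| : d(π,τ) ≥ d }   (0 if no such pair)
N : ℕ → ℕ → ℕ → ℕ
N n d r = maxList (map (λ p → ballInter n r (Data.Product.proj₁ p) (Data.Product.proj₂ p))
  (filter (λ p → d ≤? hamming (Data.Product.proj₁ p) (Data.Product.proj₂ p)) (pairs n)))

{-# OPTIONS --safe #-}

-- Permutations at distance more than 2r have disjoint r-balls, so the comparison of N and I concerns pairs π, τ
-- at distance exactly 2r. Every σ in both balls then takes one of the values π i, τ i at each position i, i.e. it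
-- chooses some cycles of ρ = π⁻¹τ. Deleting one point from a cycle of length at least 3, or deleting one point of a
-- 2-cycle and inserting the other into a different cycle, gives a pair at distance 2r − 1 whose common ball is at
-- least as large.
--
-- For the lower bound let δ = r − 2t ∈ {0, 1} and ℓ = 5 + 2δ, and compare the identity with the product of an
-- ℓ-cycle and 2t − 3 disjoint transpositions. The common ball contains the products of
--   the identity on the ℓ-cycle with t of the transpositions,
--   one of the ℓ arcs (s s+1 … s+1+δ) of the ℓ-cycle with t − 1 of the transpositions,
-- and the counterparts obtained by exchanging the roles of the two centres: the full cycle with all but t of the
-- transpositions, and an arc (s s+1 … s+3+δ) with all but t − 1 of them.
-- This gives 2 C(2t−3, t) + 2ℓ C(2t−3, t−1) permutations, and 2 C(2t−3, t−1) = C(2t−2, t−1).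
module Submission where

open import Defs
open import Data.Nat using (ℕ; _+_; _*_; _∸_; _≤_)
open import Data.Nat.Combinatorics using (_C_)
open import Data.Product using (_×_)
open import Data.Sum using (_⊎_)
open import Relation.Binary.PropositionalEquality using (_≡_)

open import Data.Nat using (zero; suc; _<_; _<ᵇ_; _≡ᵇ_; z≤n; s≤s; _≤?_; NonZero)
open import Data.Nat.Combinatorics using (nCk≡nC[n∸k]; nCk+nC[k+1]≡[n+1]C[k+1])
open import Data.Nat.Properties hiding (_≟_)
open import Data.Nat.Properties using () renaming (_≟_ to _≟ℕ_)
open import Algebra.Properties.CommutativeMonoid.Sum +-0-commutativeMonoid using (sum; sum-cong-≗; ∑-distrib-+; sum-permute; sum-replicate-zero)
open import Algebra.Properties.CommutativeSemigroup +-commutativeSemigroup using (interchange)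
open import Data.Bool using (Bool; true; false; if_then_else_; not)
open import Data.Bool.Properties using (not-involutive; not-¬)
open import Data.Fin using (Fin; zero; suc; _↑ˡ_; _↑ʳ_; splitAt; join; punchOut; opposite; toℕ)
open import Data.Fin.Permutation using (Permutation′; transpose; _∘ₚ_; _⟨$⟩ʳ_; _⟨$⟩ˡ_; inverseʳ)
open import Data.Fin.Properties using (_≟_; any?; injective⇒≤; punchOut-injective; ↑ˡ-injective; ↑ʳ-injective; splitAt-↑ˡ; splitAt-↑ʳ; join-splitAt; splitAt-join; opposite-involutive)
open import Data.List using (List; []; _∷_; _++_; map; filter; length; allFin; upTo; concatMap; tabulate)
import Data.List as List
import Data.List.Membership.DecPropositional as DecMembership
open import Data.List.Membership.Propositional using (_∈_; _∉_)
open import Data.List.Membership.Propositional.Properties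
open import Data.List.Membership.Setoid.Properties using (index-injective)
open import Data.List.Properties using (length-map; length-++; length-upTo; map-++; map-∘; map-id; concatMap-++)
open import Data.List.Relation.Unary.All using (All; []; _∷_)
import Data.List.Relation.Unary.All as All
import Data.List.Relation.Unary.All.Properties as All
open import Data.List.Relation.Unary.AllPairs using ([]; _∷_)
open import Data.List.Relation.Unary.Any using (here; there; index)
import Data.List.Relation.Unary.Any as Any
import Data.List.Relation.Unary.Unique.DecPropositional as DecUnique
open import Data.List.Relation.Unary.Unique.Propositional using (Unique)
import Data.List.Relation.Unary.Unique.Propositional.Properties as Unique
open import Data.Nat.DivMod using (_%_; _mod_)
open import Data.Nat.ListAction using () renaming (sum to sumᴸ)
open import Data.Nat.Solver using (module +-*-Solver)
open import Data.Product using (∃; _,_; proj₁; proj₂; swap)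
open import Data.Sum using (inj₁; inj₂)
import Data.Sum as Sum
open import Data.Sum.Properties using (inj₁-injective; inj₂-injective)
open import Data.Vec using (Vec; []; _∷_; lookup; toList; replicate)
import Data.Vec as Vec
open import Data.Vec.Functional using (updateAt)
open import Data.Vec.Functional.Properties using (updateAt-updates; updateAt-minimal)
open import Data.Vec.Properties using (lookup∘tabulate; tabulate∘lookup; tabulate-cong; ∷-injective; ≡-dec)
open import Function using (_∘_; id; const; Injective; case_of_)
open import Function.Bundles using (Injection)
open import Function.Properties.Inverse using (↔⇒↣)
open import Relation.Binary.PropositionalEquality using (_≢_; _≗_; refl; sym; trans; cong; cong₂; subst; setoid; module ≡-Reasoning)
open import Relation.Nullary using (Dec; yes; no; does; ¬?; contradiction)
open import Relation.Nullary.Decidable using (dec-true; dec-false; from-yes; _×-dec_)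

private
  variable
    A B : Set
    m n k : ℕ

-- Finite sums and lists

sum-mono-≤ : {f g : Fin n → ℕ} → (∀ i → f i ≤ g i) → sum f ≤ sum g
sum-mono-≤ {zero} f≤g = z≤n
sum-mono-≤ {suc n} f≤g = +-mono-≤ (f≤g zero) (sum-mono-≤ (f≤g ∘ suc))

sum-mono-< : {f g : Fin n → ℕ} → (∀ i → f i ≤ g i) → ∀ i → f i < g i → sum f < sum g
sum-mono-< f≤g zero fi<gi = +-mono-<-≤ fi<gi (sum-mono-≤ (f≤g ∘ suc))
sum-mono-< f≤g (suc i) fi<gi = +-mono-≤-< (f≤g zero) (sum-mono-< (f≤g ∘ suc) i fi<gi)

sum-updateAt : (f : Fin n → ℕ) (x : Fin n) → sum f ≡ f x + sum (updateAt f x (const 0))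
sum-updateAt f zero = refl
sum-updateAt f (suc x) = begin
  f zero + sum (f ∘ suc)       ≡⟨ cong (f zero +_) (sum-updateAt (f ∘ suc) x) ⟩
  f zero + (f (suc x) + rest)  ≡⟨ +-assoc (f zero) _ _ ⟨
  f zero + f (suc x) + rest    ≡⟨ cong (_+ rest) (+-comm (f zero) _) ⟩
  f (suc x) + f zero + rest    ≡⟨ +-assoc (f (suc x)) _ _ ⟩
  f (suc x) + (f zero + rest)  ∎
  where
  open ≡-Reasoning
  rest = sum (updateAt (f ∘ suc) x (const 0))

sumOn : List (Fin n) → (Fin n → ℕ) → ℕ
sumOn L f = sumᴸ (map f L)

sumOn-cong : (L : List (Fin n)) {f g : Fin n → ℕ} → (∀ {i} → i ∈ L → f i ≡ g i) → sumOn L f ≡ sumOn L g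
sumOn-cong [] f≗g = refl
sumOn-cong (x ∷ L) f≗g = cong₂ _+_ (f≗g (here refl)) (sumOn-cong L (f≗g ∘ there))

-- Stated with cross terms so that no truncated subtraction occurs. The induction sets both
-- functions to 0 at the head `x`; as `x` is not in the tail, the sums over the tail are unaffected.
sum-exchange : (L : List (Fin n)) → Unique L → (f g : Fin n → ℕ) →
  (∀ i → i ∉ L → f i ≡ g i) → sum f + sumOn L g ≡ sum g + sumOn L f
sum-exchange [] _ f g f≗g = cong (_+ 0) (sum-cong-≗ (λ i → f≗g i (λ ())))
sum-exchange {n} (x ∷ L) (x∉L ∷ uL) f g f≗g = begin
  sum f + (g x + sumOn L g)              ≡⟨ cong (_+ _) (sum-updateAt f x) ⟩
  f x + sum (f ∖x) + (g x + sumOn L g)   ≡⟨ interchange (f x) _ (g x) _ ⟩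
  f x + g x + (sum (f ∖x) + sumOn L g)   ≡⟨ cong (λ s → f x + g x + (sum (f ∖x) + s)) (unchanged g) ⟨
  f x + g x + (sum (f ∖x) + sumOn L (g ∖x)) ≡⟨ cong₂ _+_ (+-comm (f x) (g x)) (sum-exchange L uL (f ∖x) (g ∖x) agree) ⟩
  g x + f x + (sum (g ∖x) + sumOn L (f ∖x)) ≡⟨ cong (λ s → g x + f x + (sum (g ∖x) + s)) (unchanged f) ⟩
  g x + f x + (sum (g ∖x) + sumOn L f)   ≡⟨ interchange (g x) _ (f x) _ ⟨
  g x + sum (g ∖x) + (f x + sumOn L f)   ≡⟨ cong (_+ _) (sum-updateAt g x) ⟨
  sum g + (f x + sumOn L f)              ∎
  where
  open ≡-Reasoning
  _∖x : (Fin n → ℕ) → Fin n → ℕ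
  h ∖x = updateAt h x (const 0)
  unchanged : ∀ h → sumOn L (h ∖x) ≡ sumOn L h
  unchanged h = sumOn-cong L (λ {i} i∈L → updateAt-minimal i x h (All.lookup x∉L i∈L ∘ sym))
  agree : ∀ i → i ∉ L → (f ∖x) i ≡ (g ∖x) i
  agree i i∉L with i ≟ x
  ... | yes refl = trans (updateAt-updates i f) (sym (updateAt-updates i g))
  ... | no i≢x = trans (updateAt-minimal i x f i≢x) (trans (f≗g i i∉x∷L) (sym (updateAt-minimal i x g i≢x)))
    where
    i∉x∷L : i ∉ x ∷ L
    i∉x∷L (here i≡x) = i≢x i≡x
    i∉x∷L (there i∈L) = i∉L i∈L

lookup-injective : {xs : List A} → Unique xs → Injective _≡_ _≡_ (List.lookup xs)
lookup-injective (_ ∷ _) {zero} {zero} _ = refl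
lookup-injective {xs = _ ∷ xs} (x∉ ∷ _) {zero} {suc j} eq = contradiction eq (All.lookup x∉ (∈-lookup j))
lookup-injective {xs = _ ∷ xs} (x∉ ∷ _) {suc i} {zero} eq = contradiction (sym eq) (All.lookup x∉ (∈-lookup i))
lookup-injective (_ ∷ u) {suc i} {suc j} eq = cong suc (lookup-injective u eq)

-- Positions in `xs` are sent to positions of the images in `ys`; uniqueness of `xs` makes this an
-- injection between finite index types.
injectiveOn⇒length≤ : {xs : List A} {ys : List B} (f : A → B) → Unique xs →
  (∀ {x} → x ∈ xs → f x ∈ ys) → (∀ {x y} → x ∈ xs → y ∈ xs → f x ≡ f y → x ≡ y) →
  length xs ≤ length ys
injectiveOn⇒length≤ {xs = xs} f u into inj = injective⇒≤ {f = λ i → index (into (∈-lookup {xs = xs} i))} λ {i} {j} eq →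
  lookup-injective u (inj (∈-lookup i) (∈-lookup j)
    (index-injective (setoid _) (into (∈-lookup i)) (into (∈-lookup j)) eq))

-- If `y` were missed, punching `y` out of the codomain would inject `Fin (suc n)` into `Fin n`.
injective⇒surjective : {f : Fin n → Fin n} → Injective _≡_ _≡_ f → ∀ y → ∃ λ x → f x ≡ y
injective⇒surjective {suc n} {f} inj y with any? (λ x → f x ≟ y)
... | yes hit = hit
... | no missed = contradiction
  (injective⇒≤ {f = λ x → punchOut (miss x)} (λ {i} {j} eq → inj (punchOut-injective (miss i) (miss j) eq))) 1+n≰n
  where
  miss : ∀ x → y ≢ f x
  miss x y≡fx = missed (x , sym y≡fx)

-- Hamming distance of functions

mismatch : Fin k → Fin k → ℕ
mismatch x y = if does (x ≟ y) then 0 else 1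

mismatch-≡ : {x y : Fin k} → x ≡ y → mismatch x y ≡ 0
mismatch-≡ {x = x} {y} eq rewrite dec-true (x ≟ y) eq = refl

mismatch-≢ : {x y : Fin k} → x ≢ y → mismatch x y ≡ 1
mismatch-≢ {x = x} {y} neq rewrite dec-false (x ≟ y) neq = refl

mismatch≤1 : (x y : Fin k) → mismatch x y ≤ 1
mismatch≤1 x y with does (x ≟ y)
... | true = z≤n
... | false = s≤s z≤n

mismatch-triangle : (x y z : Fin k) → mismatch x y ≤ mismatch x z + mismatch y z
mismatch-triangle x y z with x ≟ z | y ≟ z
... | yes x≡z | yes y≡z = ≤-reflexive (mismatch-≡ (trans x≡z (sym y≡z)))
... | yes _ | no _ = mismatch≤1 x y
... | no _ | _ = ≤-trans (mismatch≤1 x y) (m≤m+n 1 _)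

dist : (Fin n → Fin k) → (Fin n → Fin k) → ℕ
dist f g = sum (λ i → mismatch (f i) (g i))

dist-cong : {f f′ g g′ : Fin n → Fin k} → f ≗ f′ → g ≗ g′ → dist f g ≡ dist f′ g′
dist-cong f≗f′ g≗g′ = sum-cong-≗ (λ i → cong₂ mismatch (f≗f′ i) (g≗g′ i))

dist-self : (f : Fin n → Fin k) → dist f f ≡ 0
dist-self {n} f = trans (sum-cong-≗ (λ i → mismatch-≡ {x = f i} refl)) (sum-replicate-zero n)

dist-triangle : (f g h : Fin n → Fin k) → dist f g ≤ dist f h + dist g h
dist-triangle f g h = ≤-trans (sum-mono-≤ (λ i → mismatch-triangle (f i) (g i) (h i)))
  (≤-reflexive (∑-distrib-+ (λ i → mismatch (f i) (h i)) (λ i → mismatch (g i) (h i))))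

-- A position where `h` differs from both `f` and `g` contributes 2 on the right of the triangle
-- inequality and at most 1 on the left, which would make the inequality strict.
dist-tight : (f g h : Fin n → Fin k) → dist f h + dist g h ≤ dist f g → ∀ i → h i ≡ f i ⊎ h i ≡ g i
dist-tight f g h tight i with h i ≟ f i | h i ≟ g i
... | yes eq | _ = inj₁ eq
... | no _ | yes eq = inj₂ eq
... | no h≢f | no h≢g = contradiction tight (<⇒≱ (<-≤-trans
  (sum-mono-< (λ j → mismatch-triangle (f j) (g j) (h j)) i strict)
  (≤-reflexive (∑-distrib-+ (λ j → mismatch (f j) (h j)) (λ j → mismatch (g j) (h j))))))
  where
  strict : mismatch (f i) (g i) < mismatch (f i) (h i) + mismatch (g i) (h i)
  strict rewrite mismatch-≢ (h≢f ∘ sym) | mismatch-≢ (h≢g ∘ sym) = s≤s (mismatch≤1 (f i) (g i))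

distOn : List (Fin n) → (Fin n → Fin k) → (Fin n → Fin k) → ℕ
distOn L f g = sumOn L (λ i → mismatch (f i) (g i))

dist-exchange : (L : List (Fin n)) → Unique L → (f g f′ g′ : Fin n → Fin k) →
  (∀ i → i ∉ L → f i ≡ f′ i) → (∀ i → i ∉ L → g i ≡ g′ i) →
  dist f g + distOn L f′ g′ ≡ dist f′ g′ + distOn L f g
dist-exchange L uL f g f′ g′ f≗f′ g≗g′ =
  sum-exchange L uL _ _ (λ i i∉L → cong₂ mismatch (f≗f′ i i∉L) (g≗g′ i i∉L))

dist-exchange-≤ : (L : List (Fin n)) → Unique L → (f g f′ g′ : Fin n → Fin k) →
  (∀ i → i ∉ L → f i ≡ f′ i) → (∀ i → i ∉ L → g i ≡ g′ i) →
  distOn L f g ≤ distOn L f′ g′ → dist f g ≤ dist f′ g′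
dist-exchange-≤ L uL f g f′ g′ f≗f′ g≗g′ on≤ = +-cancelʳ-≤ (distOn L f′ g′) _ _
  (≤-trans (≤-reflexive (dist-exchange L uL f g f′ g′ f≗f′ g≗g′)) (+-monoʳ-≤ (dist f′ g′) on≤))

distOn≤length : (L : List (Fin n)) (f g : Fin n → Fin k) → distOn L f g ≤ length L
distOn≤length [] f g = z≤n
distOn≤length (x ∷ L) f g = +-mono-≤ (mismatch≤1 (f x) (g x)) (distOn≤length L f g)

-- If all disagreements lay in `L`, exchanging `f` for `g` on `L` would bound the distance by the
-- length of `L`. This supplies the moved points needed for the shortening.
differ-outside : (L : List (Fin n)) → Unique L → (f g : Fin n → Fin k) →
  length L < dist f g → ∃ λ i → i ∉ L × f i ≢ g i
differ-outside L uL f g L<d with any? (λ i → ¬? (i ∈? L) ×-dec ¬? (f i ≟ g i))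
  where open DecMembership _≟_ using (_∈?_)
... | yes found = found
... | no none = contradiction L<d (≤⇒≯ (begin
  dist f g                     ≤⟨ m≤m+n _ _ ⟩
  dist f g + distOn L g g      ≡⟨ dist-exchange L uL f g g g agree (λ _ _ → refl) ⟩
  dist g g + distOn L f g      ≡⟨ cong (_+ distOn L f g) (dist-self g) ⟩
  distOn L f g                 ≤⟨ distOn≤length L f g ⟩
  length L                     ∎))
  where
  open ≤-Reasoning
  agree : ∀ i → i ∉ L → f i ≡ g i
  agree i i∉L with f i ≟ g i
  ... | yes eq = eq
  ... | no neq = contradiction (i , i∉L , neq) none

-- Permutations as tables

hamming≡dist : (π τ : Vec (Fin n) n) → hamming π τ ≡ dist (lookup π) (lookup τ)
hamming≡dist {n} π τ = count id
  where
  -- Generalised from `id`, since recursion on `allFin` shifts the tabulated function.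
  count : (f : Fin m → Fin n) → length (filter (λ i → ¬? (lookup π i ≟ lookup τ i)) (tabulate f))
    ≡ sum (λ i → mismatch (lookup π (f i)) (lookup τ (f i)))
  count {zero} f = refl
  count {suc m} f with does (lookup π (f zero) ≟ lookup τ (f zero))
  ... | true = count (f ∘ suc)
  ... | false = cong suc (count (f ∘ suc))

toList-tabulate : (f : Fin n → A) → toList (Vec.tabulate f) ≡ tabulate f
toList-tabulate {zero} f = refl
toList-tabulate {suc n} f = cong (f zero ∷_) (toList-tabulate (f ∘ suc))

lookup-cong⇒≡ : {v w : Vec A n} → lookup v ≗ lookup w → v ≡ w
lookup-cong⇒≡ {v = v} {w} eq = trans (sym (tabulate∘lookup v)) (trans (tabulate-cong eq) (tabulate∘lookup w))

IsPerm : Vec (Fin n) n → Set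
IsPerm v = Injective _≡_ _≡_ (lookup v)

tabulate-isPerm : {f : Fin n → Fin n} → Injective _≡_ _≡_ f → IsPerm (Vec.tabulate f)
tabulate-isPerm {f = f} inj {i} {j} eq =
  inj (trans (sym (lookup∘tabulate f i)) (trans eq (lookup∘tabulate f j)))

∈-allVecs : (v : Vec (Fin n) k) → v ∈ allVecs n k
∈-allVecs [] = here refl
∈-allVecs {n} {suc k} (x ∷ v) = ∈-concatMap⁺ (λ i → map (i ∷_) (allVecs n k))
  (Any.map (λ { refl → ∈-map⁺ (x ∷_) (∈-allVecs v) }) (∈-allFin x))

-- Recasts the recursion of `allVecs` as a cartesian product, to which the uniqueness lemma for
-- products applies.
concatMap-map : {C : Set} (f : A → B → C) (xs : List A) (ys : List B) →
  concatMap (λ x → map (f x) ys) xs ≡ List.cartesianProductWith f xs ys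
concatMap-map f [] ys = refl
concatMap-map f (x ∷ xs) ys = cong (map (f x) ys ++_) (concatMap-map f xs ys)

allVecs-unique : ∀ n k → Unique (allVecs n k)
allVecs-unique n zero = [] ∷ []
allVecs-unique n (suc k) = subst Unique (sym (concatMap-map _∷_ (allFin n) (allVecs n k)))
  (Unique.cartesianProductWith⁺ _∷_ ∷-injective (Unique.allFin⁺ n) (allVecs-unique n k))

Sym-unique : ∀ n → Unique (Sym n)
Sym-unique n = Unique.filter⁺ _ (allVecs-unique n n)

∈-Sym⁺ : {v : Vec (Fin n) n} → IsPerm v → v ∈ Sym n
∈-Sym⁺ {v = v} inj = ∈-filter⁺ _ (∈-allVecs v) (subst Unique
  (trans (sym (toList-tabulate (lookup v))) (cong toList (tabulate∘lookup v))) (Unique.tabulate⁺ inj))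

unique⇒isPerm : (v : Vec (Fin n) n) → Unique (toList v) → IsPerm v
unique⇒isPerm = unique
  where
  lookup-∈ : (w : Vec A k) (i : Fin k) → lookup w i ∈ toList w
  lookup-∈ (x ∷ w) zero = here refl
  lookup-∈ (x ∷ w) (suc i) = there (lookup-∈ w i)
  unique : (w : Vec A k) → Unique (toList w) → Injective _≡_ _≡_ (lookup w)
  unique (x ∷ w) _ {zero} {zero} _ = refl
  unique (x ∷ w) (x∉ ∷ _) {zero} {suc j} eq = contradiction eq (All.lookup x∉ (lookup-∈ w j))
  unique (x ∷ w) (x∉ ∷ _) {suc i} {zero} eq = contradiction (sym eq) (All.lookup x∉ (lookup-∈ w i))
  unique (x ∷ w) (_ ∷ u) {suc i} {suc j} eq = cong suc (unique w u eq)

∈-Sym⁻ : {v : Vec (Fin n) n} → v ∈ Sym n → IsPerm v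
∈-Sym⁻ {n} {v} v∈ = unique⇒isPerm v (proj₂ (∈-filter⁻ _ {xs = allVecs n n} v∈))

-- Common balls of two permutations

module _ (n r : ℕ) (π τ : Vec (Fin n) n) where

  commonBall : List (Vec (Fin n) n)
  commonBall = filter (λ σ → (hamming π σ ≤? r) ×-dec (hamming τ σ ≤? r)) (Sym n)

  ∈-commonBall⁺ : {σ : Vec (Fin n) n} → IsPerm σ → dist (lookup π) (lookup σ) ≤ r →
    dist (lookup τ) (lookup σ) ≤ r → σ ∈ commonBall
  ∈-commonBall⁺ {σ} inj πσ τσ = ∈-filter⁺ _ (∈-Sym⁺ inj)
    (≤-trans (≤-reflexive (hamming≡dist π σ)) πσ , ≤-trans (≤-reflexive (hamming≡dist τ σ)) τσ)

  ∈-commonBall⁻ : {σ : Vec (Fin n) n} → σ ∈ commonBall →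
    IsPerm σ × dist (lookup π) (lookup σ) ≤ r × dist (lookup τ) (lookup σ) ≤ r
  ∈-commonBall⁻ {σ} σ∈ with σ∈Sym , πσ , τσ ← ∈-filter⁻ _ {xs = Sym n} σ∈ =
    ∈-Sym⁻ σ∈Sym , ≤-trans (≤-reflexive (sym (hamming≡dist π σ))) πσ
                 , ≤-trans (≤-reflexive (sym (hamming≡dist τ σ))) τσ

  commonBall-unique : Unique commonBall
  commonBall-unique = Unique.filter⁺ _ (Sym-unique n)

  -- A member of both balls would force distance at most r + r by the triangle inequality.
  ballInter-far : 2 * r < dist (lookup π) (lookup τ) → ballInter n r π τ ≡ 0
  ballInter-far far with commonBall in eq
  ... | [] = refl
  ... | σ ∷ _ with _ , πσ , τσ ← ∈-commonBall⁻ (subst (σ ∈_) (sym eq) (here refl)) =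
    contradiction far (≤⇒≯ (≤-trans (dist-triangle (lookup π) (lookup τ) (lookup σ))
      (≤-trans (+-mono-≤ πσ τσ) (≤-reflexive (cong (r +_) (sym (+-identityʳ r)))))))

-- Bounds for maxima, `I` and `N`

maxList-upper : (f : A → ℕ) {x : A} {xs : List A} → x ∈ xs → f x ≤ maxList (map f xs)
maxList-upper f {xs = y ∷ ys} (here refl) = m≤m⊔n (f y) (maxList (map f ys))
maxList-upper f {xs = y ∷ ys} (there x∈) = ≤-trans (maxList-upper f x∈) (m≤n⊔m (f y) (maxList (map f ys)))

maxList-least : {f : A → ℕ} {b : ℕ} (xs : List A) → (∀ {x} → x ∈ xs → f x ≤ b) → maxList (map f xs) ≤ b
maxList-least [] _ = z≤n
maxList-least (x ∷ xs) bound = ⊔-lub (bound (here refl)) (maxList-least xs (bound ∘ there))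

I-upper : ∀ {n d r} (π τ : Vec (Fin n) n) → IsPerm π → IsPerm τ →
  dist (lookup π) (lookup τ) ≡ d → ballInter n r π τ ≤ I n d r
I-upper π τ pπ pτ eq = maxList-upper _ (∈-filter⁺ _
  (∈-cartesianProduct⁺ (∈-Sym⁺ {v = π} pπ) (∈-Sym⁺ {v = τ} pτ)) (trans (hamming≡dist π τ) eq))

I≤N : ∀ n d r → I n d r ≤ N n d r
I≤N n d r = maxList-least _ λ p∈ → case ∈-filter⁻ _ {xs = pairs n} p∈ of λ where
  (p∈pairs , eq) → maxList-upper _ (∈-filter⁺ _ p∈pairs (≤-reflexive (sym eq)))

N-least : ∀ {n d r b} → (∀ (π τ : Vec (Fin n) n) → IsPerm π → IsPerm τ →
  d ≤ dist (lookup π) (lookup τ) → ballInter n r π τ ≤ b) → N n d r ≤ b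
N-least {n} {d} {r} {b} bound = maxList-least _ λ {p} p∈ → case ∈-filter⁻ _ {xs = pairs n} p∈ of λ where
  (p∈pairs , d≤) → case ∈-cartesianProduct⁻ (Sym n) (Sym n) p∈pairs of λ where
    (π∈ , τ∈) → bound (proj₁ p) (proj₂ p) (∈-Sym⁻ π∈) (∈-Sym⁻ τ∈)
      (≤-trans d≤ (≤-reflexive (hamming≡dist (proj₁ p) (proj₂ p))))

-- Distance 2r reduces to distance 2r − 1

transposeˡ : (i j : Fin n) → transpose i j ⟨$⟩ʳ i ≡ j
transposeˡ i j rewrite dec-true (i ≟ i) refl = refl

transposeʳ : (i j : Fin n) → transpose i j ⟨$⟩ʳ j ≡ i
transposeʳ i j with j ≟ i
... | yes j≡i = j≡i
... | no _ rewrite dec-true (j ≟ j) refl = refl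

transpose-other : (i j : Fin n) {l : Fin n} → l ≢ i → l ≢ j → transpose i j ⟨$⟩ʳ l ≡ l
transpose-other i j {l} l≢i l≢j rewrite dec-false (l ≟ i) l≢i | dec-false (l ≟ j) l≢j = refl

Mixed : (π τ σ : Fin n → Fin n) → Set
Mixed π τ σ = ∀ i → σ i ≡ π i ⊎ σ i ≡ τ i

-- Every permutation σ in the common ball of π and τ is mixed. It is sent to σ ∘ g or to σ itself,
-- according to whether it follows τ or π at the key; this injects into the common ball of π and τ ∘ g.
record Shortening (π τ : Fin n → Fin n) : Set where
  field
    g : Permutation′ n
    key : Fin n
  _∘g : (Fin n → Fin n) → Fin n → Fin n
  (f ∘g) i = f (g ⟨$⟩ʳ i)
  field
    shorter : suc (dist π (τ ∘g)) ≡ dist π τ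
    -- Only the centre π needs an estimate here: composing both τ and σ with `g` leaves their
    -- distance unchanged.
    moved : ∀ {σ} → Injective _≡_ _≡_ σ → σ key ≡ τ key → dist π (σ ∘g) ≤ dist π σ
    kept : ∀ {σ} → Injective _≡_ _≡_ σ → Mixed π τ σ →
      σ key ≡ π key → dist (τ ∘g) σ ≤ dist τ σ
    -- A σ that is left alone has the value π key at the key, so this keeps the two kinds of images
    -- apart.
    separated : ∀ {σ} → Mixed π τ σ → (σ ∘g) key ≢ π key

module _ {π τ : Fin n → Fin n} (π-inj : Injective _≡_ _≡_ π) (τ-inj : Injective _≡_ _≡_ τ)
  {c d : Fin n} (c-moved : π c ≢ τ c) (πd≡τc : π d ≡ τ c) where

  private
    c≢d : c ≢ d
    c≢d refl = c-moved πd≡τc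

    d-moved : π d ≢ τ d
    d-moved eq = c≢d (τ-inj (trans (sym πd≡τc) eq))

  -- Write ρ = π⁻¹τ, so d = ρ c. Here the cycle of ρ through c has length at least 3; d is removed from it.
  shorten-long : τ d ≢ π c → Shortening π τ
  shorten-long τd≢πc = record
    { g = g ; key = c ; shorter = +-cancelʳ-≡ 1 _ _ shorter′
    ; moved = moved′ ; kept = kept′ ; separated = separated′ }
    where
    g = transpose c d
    _∘g : (Fin n → Fin n) → Fin n → Fin n
    (f ∘g) i = f (g ⟨$⟩ʳ i)
    L = c ∷ d ∷ []
    uL : Unique L
    uL = (c≢d ∷ []) ∷ [] ∷ []
    fixed : ∀ f i → i ∉ L → (f ∘g) i ≡ f i
    fixed f i i∉L = cong f (transpose-other c d (i∉L ∘ here) (i∉L ∘ there ∘ here))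
    same : ∀ f i → i ∉ L → f i ≡ f i
    same f i _ = refl
    gc : ∀ f → (f ∘g) c ≡ f d
    gc f = cong f (transposeˡ c d)
    gd : ∀ f → (f ∘g) d ≡ f c
    gd f = cong f (transposeʳ c d)
    old : distOn L π τ ≡ 2
    old = cong₂ _+_ (mismatch-≢ c-moved) (cong₂ _+_ (mismatch-≢ d-moved) refl)
    -- After the swap, d agrees with π because τ c = π d, while c still disagrees because τ d ≠ π c.
    new : distOn L π (τ ∘g) ≡ 1
    new = cong₂ _+_ (mismatch-≢ (λ eq → τd≢πc (sym (trans eq (gc τ)))))
      (cong₂ _+_ (mismatch-≡ (trans πd≡τc (sym (gd τ)))) refl)
    shorter′ : suc (dist π (τ ∘g)) + 1 ≡ dist π τ + 1
    shorter′ = begin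
      suc (dist π (τ ∘g)) + 1            ≡⟨ +-suc (dist π (τ ∘g)) 1 ⟨
      dist π (τ ∘g) + 2                  ≡⟨ cong (dist π (τ ∘g) +_) old ⟨
      dist π (τ ∘g) + distOn L π τ       ≡⟨ dist-exchange L uL π (τ ∘g) π τ (same π) (fixed τ) ⟩
      dist π τ + distOn L π (τ ∘g)       ≡⟨ cong (dist π τ +_) new ⟩
      dist π τ + 1                       ∎
      where open ≡-Reasoning
    moved′ : ∀ {σ} → Injective _≡_ _≡_ σ → σ c ≡ τ c → dist π (σ ∘g) ≤ dist π σ
    moved′ {σ} σ-inj σc≡τc = dist-exchange-≤ L uL π (σ ∘g) π σ (same π) (fixed σ) (begin
      distOn L π (σ ∘g)  ≤⟨ +-mono-≤ (mismatch≤1 (π c) ((σ ∘g) c)) (≤-reflexive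
        (cong (_+ 0) (mismatch-≡ (trans πd≡τc (sym (trans (gd σ) σc≡τc)))))) ⟩
      1                  ≡⟨ mismatch-≢ (λ eq → c-moved (trans eq σc≡τc)) ⟨
      mismatch (π c) (σ c) ≤⟨ m≤m+n _ _ ⟩
      distOn L π σ       ∎)
      where open ≤-Reasoning
    kept′ : ∀ {σ} → Injective _≡_ _≡_ σ → Mixed π τ σ →
      σ c ≡ π c → dist (τ ∘g) σ ≤ dist τ σ
    kept′ {σ} σ-inj mixed σc≡πc = dist-exchange-≤ L uL (τ ∘g) σ τ σ (fixed τ) (same σ) (begin
      distOn L (τ ∘g) σ  ≤⟨ +-mono-≤ (mismatch≤1 ((τ ∘g) c) (σ c)) (≤-reflexive
        (cong (_+ 0) (mismatch-≡ (trans (gd τ) (trans (sym πd≡τc) (sym σd≡πd)))))) ⟩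
      1                  ≡⟨ mismatch-≢ (λ eq → c-moved (sym (trans eq σc≡πc))) ⟨
      mismatch (τ c) (σ c) ≤⟨ m≤m+n _ _ ⟩
      distOn L τ σ       ∎)
      where
      open ≤-Reasoning
      -- Some z has σ z = π d = τ c. As σ is mixed, z is d or c, and z = c would give π c = σ c = τ
      -- c.
      σd≡πd : σ d ≡ π d
      σd≡πd with z , σz≡πd ← injective⇒surjective σ-inj (π d) with mixed z
      ... | inj₁ σz≡πz with refl ← π-inj (trans (sym σz≡πz) σz≡πd) = σz≡πd
      ... | inj₂ σz≡τz with refl ← τ-inj (trans (sym σz≡τz) (trans σz≡πd πd≡τc)) =
        contradiction (trans (sym σc≡πc) σz≡τz) c-moved
    separated′ : ∀ {σ} → Mixed π τ σ → (σ ∘g) c ≢ π c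
    separated′ {σ} mixed eq with mixed d
    ... | inj₁ σd≡πd = c≢d (π-inj (trans (sym eq) (trans (gc σ) σd≡πd)))
    ... | inj₂ σd≡τd = τd≢πc (trans (sym σd≡τd) (trans (sym (gc σ)) eq))

  -- Here (c d) is a 2-cycle of ρ: d is removed and c is merged into the cycle of another moved point b.
  shorten-two : τ d ≡ π c → {b : Fin n} → π b ≢ τ b → b ≢ c → b ≢ d → Shortening π τ
  shorten-two τd≡πc {b} b-moved b≢c b≢d = record
    { g = g ; key = c ; shorter = +-cancelʳ-≡ 2 _ _ shorter′
    ; moved = moved′ ; kept = kept′ ; separated = separated′ }
    where
    -- The left factor acts first, so `g` is the 3-cycle b → d → c → b.
    g = transpose b c ∘ₚ transpose c d
    _∘g : (Fin n → Fin n) → Fin n → Fin n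
    (f ∘g) i = f (g ⟨$⟩ʳ i)
    L = b ∷ c ∷ d ∷ []
    uL : Unique L
    uL = (b≢c ∷ b≢d ∷ []) ∷ (c≢d ∷ []) ∷ [] ∷ []
    fixed : ∀ f i → i ∉ L → (f ∘g) i ≡ f i
    fixed f i i∉L = cong f (trans
      (cong (transpose c d ⟨$⟩ʳ_) (transpose-other b c (i∉L ∘ here) (i∉L ∘ there ∘ here)))
      (transpose-other c d (i∉L ∘ there ∘ here) (i∉L ∘ there ∘ there ∘ here)))
    same : ∀ f i → i ∉ L → f i ≡ f i
    same f i _ = refl
    gb : ∀ f → (f ∘g) b ≡ f d
    gb f = cong f (trans (cong (transpose c d ⟨$⟩ʳ_) (transposeˡ b c)) (transposeˡ c d))
    gc : ∀ f → (f ∘g) c ≡ f b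
    gc f = cong f (trans (cong (transpose c d ⟨$⟩ʳ_) (transposeʳ b c)) (transpose-other c d b≢c b≢d))
    gd : ∀ f → (f ∘g) d ≡ f c
    gd f = cong f (trans (cong (transpose c d ⟨$⟩ʳ_) (transpose-other b c (b≢d ∘ sym) (c≢d ∘ sym))) (transposeʳ c d))
    τb≢πc : τ b ≢ π c
    τb≢πc eq = b≢d (τ-inj (trans eq (sym τd≡πc)))
    old : distOn L π τ ≡ 3
    old = cong₂ _+_ (mismatch-≢ b-moved) (cong₂ _+_ (mismatch-≢ c-moved) (cong₂ _+_ (mismatch-≢ d-moved) refl))
    -- τ ∘ g takes the values τ d = π c at b, τ b at c and τ c = π d at d, so only d comes to agree
    -- with π.
    new : distOn L π (τ ∘g) ≡ 2
    new = cong₂ _+_ (mismatch-≢ (λ eq → b≢c (π-inj (trans eq (trans (gb τ) τd≡πc)))))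
      (cong₂ _+_ (mismatch-≢ (λ eq → τb≢πc (sym (trans eq (gc τ)))))
      (cong₂ _+_ (mismatch-≡ (trans πd≡τc (sym (gd τ)))) refl))
    shorter′ : suc (dist π (τ ∘g)) + 2 ≡ dist π τ + 2
    shorter′ = begin
      suc (dist π (τ ∘g)) + 2            ≡⟨ +-suc (dist π (τ ∘g)) 2 ⟨
      dist π (τ ∘g) + 3                  ≡⟨ cong (dist π (τ ∘g) +_) old ⟨
      dist π (τ ∘g) + distOn L π τ       ≡⟨ dist-exchange L uL π (τ ∘g) π τ (same π) (fixed τ) ⟩
      dist π τ + distOn L π (τ ∘g)       ≡⟨ cong (dist π τ +_) new ⟩
      dist π τ + 2                       ∎
      where open ≡-Reasoning
    moved′ : ∀ {σ} → Injective _≡_ _≡_ σ → σ c ≡ τ c → dist π (σ ∘g) ≤ dist π σ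
    moved′ {σ} σ-inj σc≡τc = dist-exchange-≤ L uL π (σ ∘g) π σ (same π) (fixed σ) (begin
      distOn L π (σ ∘g)  ≤⟨ +-mono-≤ (mismatch≤1 (π b) ((σ ∘g) b)) (+-mono-≤ (mismatch≤1 (π c) ((σ ∘g) c))
        (≤-reflexive (cong (_+ 0) (mismatch-≡ (trans πd≡τc (sym (trans (gd σ) σc≡τc))))))) ⟩
      -- Before the move both c and d count: σ c = τ c ≠ π c, and the value π d = τ c is already
      -- taken at c, so σ d ≠ π d.
      2                  ≡⟨ cong₂ _+_ (mismatch-≢ (λ eq → c-moved (trans eq σc≡τc)))
        (cong (_+ 0) (mismatch-≢ (λ eq → c≢d (σ-inj (trans σc≡τc (trans (sym πd≡τc) eq)))))) ⟨
      distOn (c ∷ d ∷ []) π σ ≤⟨ m≤n+m _ (mismatch (π b) (σ b)) ⟩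
      distOn L π σ       ∎)
      where open ≤-Reasoning
    kept′ : ∀ {σ} → Injective _≡_ _≡_ σ → Mixed π τ σ →
      σ c ≡ π c → dist (τ ∘g) σ ≤ dist τ σ
    kept′ {σ} σ-inj mixed σc≡πc = dist-exchange-≤ L uL (τ ∘g) σ τ σ (fixed τ) (same σ) (begin
      distOn L (τ ∘g) σ  ≤⟨ +-mono-≤ (mismatch≤1 ((τ ∘g) b) (σ b)) (+-mono-≤ (mismatch≤1 ((τ ∘g) c) (σ c))
        (≤-reflexive (cong (_+ 0) (mismatch-≡ (trans (gd τ) (trans (sym πd≡τc) (sym σd≡πd))))))) ⟩
      2                  ≡⟨ cong₂ _+_ (mismatch-≢ (λ eq → c-moved (sym (trans eq σc≡πc))))
        (cong (_+ 0) (mismatch-≢ (λ eq → c≢d (σ-inj (trans σc≡πc (trans (sym τd≡πc) eq)))))) ⟨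
      distOn (c ∷ d ∷ []) τ σ ≤⟨ m≤n+m _ (mismatch (τ b) (σ b)) ⟩
      distOn L τ σ       ∎)
      where
      open ≤-Reasoning
      σd≡πd : σ d ≡ π d
      σd≡πd with mixed d
      ... | inj₁ eq = eq
      ... | inj₂ σd≡τd = contradiction (σ-inj (trans σc≡πc (trans (sym τd≡πc) (sym σd≡τd)))) c≢d
    separated′ : ∀ {σ} → Mixed π τ σ → (σ ∘g) c ≢ π c
    separated′ {σ} mixed eq with mixed b
    ... | inj₁ σb≡πb = b≢c (π-inj (trans (sym σb≡πb) (trans (sym (gc σ)) eq)))
    ... | inj₂ σb≡τb = τb≢πc (trans (sym σb≡τb) (trans (sym (gc σ)) eq))

-- The cases are whether the cycle of ρ through a moved point c has length 2. If it does, a distance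
-- above 2 provides a moved point b outside that cycle.
shorten : {π τ : Fin n → Fin n} → Injective _≡_ _≡_ π → Injective _≡_ _≡_ τ → 2 < dist π τ → Shortening π τ
shorten {π = π} {τ} π-inj τ-inj 2<d
  with c , _ , c-moved ← differ-outside [] [] π τ (≤-trans (s≤s z≤n) 2<d)
  with d , πd≡τc ← injective⇒surjective π-inj (τ c)
  with τ d ≟ π c
... | no τd≢πc = shorten-long π-inj τ-inj c-moved πd≡τc τd≢πc
... | yes τd≡πc
  with b , b∉ , b-moved ← differ-outside (c ∷ d ∷ [])
    (((λ { refl → c-moved πd≡τc }) ∷ []) ∷ [] ∷ []) π τ 2<d =
  shorten-two π-inj τ-inj c-moved πd≡τc τd≡πc b-moved (b∉ ∘ here) (b∉ ∘ there ∘ here)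

-- Comparison of `N` with `I`

ballInter-≤-I : ∀ {n r} (π τ : Vec (Fin n) n) → IsPerm π → IsPerm τ → 1 < r →
  dist (lookup π) (lookup τ) ≡ 2 * r → ballInter n r π τ ≤ I n (2 * r ∸ 1) r
ballInter-≤-I {n} {r} π τ π-inj τ-inj 1<r d≡2r = ≤-trans
  (injectiveOn⇒length≤ move (commonBall-unique n r π τ) move-into move-injective)
  (I-upper π τ′ π-inj τ′-inj (trans (dist-cong {f = lookup π} (λ _ → refl) lookup-τ′) (cong (_∸ 1) (trans shorter d≡2r))))
  where
  open Shortening (shorten π-inj τ-inj (≤-trans (*-monoʳ-< 2 1<r) (≤-reflexive (sym d≡2r))))
  ∘g-inj : {f : Fin n → Fin n} → Injective _≡_ _≡_ f → Injective _≡_ _≡_ (f ∘g)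
  ∘g-inj f-inj = Injection.injective (↔⇒↣ g) ∘ f-inj
  _∘̂g : Vec (Fin n) n → Vec (Fin n) n
  v ∘̂g = Vec.tabulate (lookup v ∘g)
  τ′ = τ ∘̂g
  τ′-inj : IsPerm τ′
  τ′-inj = tabulate-isPerm (∘g-inj τ-inj)
  lookup-τ′ : lookup τ′ ≗ lookup τ ∘g
  lookup-τ′ = lookup∘tabulate (lookup τ ∘g)
  move : Vec (Fin n) n → Vec (Fin n) n
  move σ with lookup σ key ≟ lookup τ key
  ... | yes _ = σ ∘̂g
  ... | no _ = σ
  mixed : ∀ {σ} → σ ∈ commonBall n r π τ → Mixed (lookup π) (lookup τ) (lookup σ)
  -- The two radii add up to exactly the distance 2r of the centres, so the triangle inequality
  -- through σ is tight.
  mixed {σ} σ∈ with _ , πσ , τσ ← ∈-commonBall⁻ n r π τ σ∈ = dist-tight (lookup π) (lookup τ) (lookup σ)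
    (≤-trans (+-mono-≤ πσ τσ) (≤-reflexive (trans (cong (r +_) (sym (+-identityʳ r))) (sym d≡2r))))
  key-π : ∀ {σ} → σ ∈ commonBall n r π τ → lookup σ key ≢ lookup τ key → lookup σ key ≡ lookup π key
  key-π σ∈ neq with mixed σ∈ key
  ... | inj₁ eq = eq
  ... | inj₂ eq = contradiction eq neq
  move-into : ∀ {σ} → σ ∈ commonBall n r π τ → move σ ∈ commonBall n r π τ′
  move-into {σ} σ∈ with σ-inj , πσ , τσ ← ∈-commonBall⁻ n r π τ σ∈
    with lookup σ key ≟ lookup τ key
  ... | yes eq = ∈-commonBall⁺ n r π τ′ (tabulate-isPerm (∘g-inj σ-inj))
    (≤-trans (≤-reflexive (dist-cong {f = lookup π} (λ _ → refl) (lookup∘tabulate _))) (≤-trans (moved σ-inj eq) πσ))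
    -- Precomposing both arguments with `g` only permutes the summands of the distance.
    (≤-trans (≤-reflexive (trans (dist-cong lookup-τ′ (lookup∘tabulate _)) (sym (sum-permute _ g)))) τσ)
  ... | no neq = ∈-commonBall⁺ n r π τ′ σ-inj πσ
    (≤-trans (≤-reflexive (dist-cong {g = lookup σ} lookup-τ′ (λ _ → refl))) (≤-trans (kept σ-inj (mixed σ∈) (key-π σ∈ neq)) τσ))
  ∘̂g-injective : ∀ {v w} → v ∘̂g ≡ w ∘̂g → v ≡ w
  ∘̂g-injective {v} {w} eq = lookup-cong⇒≡ λ i → begin
    lookup v i                       ≡⟨ cong (lookup v) (inverseʳ g) ⟨
    (lookup v ∘g) (g ⟨$⟩ˡ i)         ≡⟨ lookup∘tabulate (lookup v ∘g) _ ⟨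
    lookup (v ∘̂g) (g ⟨$⟩ˡ i)         ≡⟨ cong (λ u → lookup u (g ⟨$⟩ˡ i)) eq ⟩
    lookup (w ∘̂g) (g ⟨$⟩ˡ i)         ≡⟨ lookup∘tabulate (lookup w ∘g) _ ⟩
    (lookup w ∘g) (g ⟨$⟩ˡ i)         ≡⟨ cong (lookup w) (inverseʳ g) ⟩
    lookup w i                       ∎
    where open ≡-Reasoning
  clash : ∀ {v w} → v ∈ commonBall n r π τ → w ∈ commonBall n r π τ →
    lookup w key ≢ lookup τ key → v ∘̂g ≢ w
  clash {v} v∈ w∈ wneq refl =
    separated (mixed v∈) (trans (sym (lookup∘tabulate (lookup v ∘g) key)) (key-π w∈ wneq))
  move-injective : ∀ {v w} → v ∈ commonBall n r π τ → w ∈ commonBall n r π τ → move v ≡ move w → v ≡ w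
  move-injective {v} {w} v∈ w∈ eq with lookup v key ≟ lookup τ key | lookup w key ≟ lookup τ key
  ... | yes _ | yes _ = ∘̂g-injective eq
  ... | yes _ | no wneq = contradiction eq (clash v∈ w∈ wneq)
  ... | no vneq | yes _ = contradiction (sym eq) (clash w∈ v∈ vneq)
  ... | no _ | no _ = eq

ballInter-≤-I-far : ∀ {n r} (π τ : Vec (Fin n) n) → IsPerm π → IsPerm τ → 1 < r →
  2 * r ≤ dist (lookup π) (lookup τ) → ballInter n r π τ ≤ I n (2 * r ∸ 1) r
ballInter-≤-I-far {n} {r} π τ π-inj τ-inj 1<r 2r≤d with m≤n⇒m<n∨m≡n 2r≤d
... | inj₁ 2r<d = ≤-trans (≤-reflexive (ballInter-far n r π τ 2r<d)) z≤n
... | inj₂ 2r≡d = ballInter-≤-I π τ π-inj τ-inj 1<r (sym 2r≡d)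

N-2r≤I : ∀ n {r} → 1 < r → N n (2 * r) r ≤ I n (2 * r ∸ 1) r
N-2r≤I n {r} 1<r = N-least {n} {2 * r} {r} λ π τ π-inj τ-inj → ballInter-≤-I-far π τ π-inj τ-inj 1<r

N≡I : ∀ n {r} → 1 < r → N n (2 * r ∸ 1) r ≡ I n (2 * r ∸ 1) r
N≡I n {r@(suc _)} 1<r = ≤-antisym (N-least {n} {2 * r ∸ 1} {r} bound) (I≤N n _ r)
  where
  bound : ∀ (π τ : Vec (Fin n) n) → IsPerm π → IsPerm τ →
    2 * r ∸ 1 ≤ dist (lookup π) (lookup τ) → ballInter n r π τ ≤ I n (2 * r ∸ 1) r
  bound π τ π-inj τ-inj d≤ with m≤n⇒m<n∨m≡n d≤
  -- As `r` is a successor, `suc (2 * r ∸ 1)` computes to `2 * r`, so the strict case is distance at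
  -- least 2r.
  ... | inj₁ d< = ballInter-≤-I-far π τ π-inj τ-inj 1<r d<
  ... | inj₂ d≡ = I-upper π τ π-inj τ-inj (sym d≡)

-- Direct sums of permutations

_⊕_ : (Fin m → Fin m) → (Fin n → Fin n) → Fin (m + n) → Fin (m + n)
_⊕_ {m} {n} f g i = join m n (Sum.map f g (splitAt m i))

module _ (f : Fin m → Fin m) (g : Fin n → Fin n) where

  ⊕-↑ˡ : ∀ i → (f ⊕ g) (i ↑ˡ n) ≡ f i ↑ˡ n
  ⊕-↑ˡ i = cong (join m n ∘ Sum.map f g) (splitAt-↑ˡ m i n)

  ⊕-↑ʳ : ∀ i → (f ⊕ g) (m ↑ʳ i) ≡ m ↑ʳ g i
  ⊕-↑ʳ i = cong (join m n ∘ Sum.map f g) (splitAt-↑ʳ m n i)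

  ⊕-injective : Injective _≡_ _≡_ f → Injective _≡_ _≡_ g → Injective _≡_ _≡_ (f ⊕ g)
  ⊕-injective f-inj g-inj {i} {j} eq = trans (sym (join-splitAt m n i))
    (trans (cong (join m n) (map-injective (splitAt m i) (splitAt m j)
      (trans (sym (splitAt-join m n _)) (trans (cong (splitAt m) eq) (splitAt-join m n _)))))
      (join-splitAt m n j))
    where
    map-injective : ∀ x y → Sum.map f g x ≡ Sum.map f g y → x ≡ y
    map-injective (inj₁ x) (inj₁ y) e = cong inj₁ (f-inj (inj₁-injective e))
    map-injective (inj₂ x) (inj₂ y) e = cong inj₂ (g-inj (inj₂-injective e))

module _ {f f′ : Fin m → Fin m} {g g′ : Fin n → Fin n} (eq : f ⊕ g ≗ f′ ⊕ g′) where

  ⊕-cancelˡ : f ≗ f′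
  ⊕-cancelˡ i = ↑ˡ-injective n _ _ (trans (sym (⊕-↑ˡ f g i)) (trans (eq _) (⊕-↑ˡ f′ g′ i)))

  ⊕-cancelʳ : g ≗ g′
  ⊕-cancelʳ i = ↑ʳ-injective m _ _ (trans (sym (⊕-↑ʳ f g i)) (trans (eq _) (⊕-↑ʳ f′ g′ i)))

mismatch-injective : {h : Fin m → Fin n} → Injective _≡_ _≡_ h → ∀ x y → mismatch (h x) (h y) ≡ mismatch x y
mismatch-injective {h = h} h-inj x y with x ≟ y
... | yes refl = mismatch-≡ {x = h x} refl
... | no x≢y = mismatch-≢ (x≢y ∘ h-inj)

sum-+ : ∀ m (f : Fin (m + n) → ℕ) → sum f ≡ sum (λ i → f (i ↑ˡ n)) + sum (λ i → f (m ↑ʳ i))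
sum-+ zero f = refl
sum-+ (suc m) f = trans (cong (f zero +_) (sum-+ m (f ∘ suc))) (sym (+-assoc (f zero) _ _))

dist-⊕ : (f f′ : Fin m → Fin m) (g g′ : Fin n → Fin n) → dist (f ⊕ g) (f′ ⊕ g′) ≡ dist f f′ + dist g g′
dist-⊕ {m} {n} f f′ g g′ = trans (sum-+ m _) (cong₂ _+_
  (sum-cong-≗ λ i → trans (cong₂ mismatch (⊕-↑ˡ f g i) (⊕-↑ˡ f′ g′ i))
    (mismatch-injective (↑ˡ-injective n _ _) (f i) (f′ i)))
  (sum-cong-≗ λ i → trans (cong₂ mismatch (⊕-↑ʳ f g i) (⊕-↑ʳ f′ g′ i))
    (mismatch-injective (↑ʳ-injective m _ _) (g i) (g′ i))))

-- Products of disjoint transpositions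

flip₂ : Bool → Fin 2 → Fin 2
flip₂ b = if b then opposite else id

flip₂-injective : ∀ b → Injective _≡_ _≡_ (flip₂ b)
flip₂-injective false eq = eq
flip₂-injective true {i} {j} eq = trans (sym (opposite-involutive i)) (trans (cong opposite eq) (opposite-involutive j))

flip₂-cancel : ∀ b b′ → flip₂ b ≗ flip₂ b′ → b ≡ b′
flip₂-cancel false false _ = refl
flip₂-cancel false true eq with () ← eq zero
flip₂-cancel true false eq with () ← eq zero
flip₂-cancel true true _ = refl

dist-flip₂ : ∀ b → dist (flip₂ (not b)) (flip₂ b) ≡ 2
dist-flip₂ false = refl
dist-flip₂ true = refl

-- Each letter governs one block of two points, `true` meaning swapped. The last `e` points stay
-- fixed; they pad the construction to larger n.
flips : ∀ e → Vec Bool m → Fin (m * 2 + e) → Fin (m * 2 + e)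
flips e [] = id
flips e (b ∷ bs) = flip₂ b ⊕ flips e bs

flips-injective : ∀ e (bs : Vec Bool m) → Injective _≡_ _≡_ (flips e bs)
flips-injective e [] eq = eq
flips-injective e (b ∷ bs) = ⊕-injective (flip₂ b) (flips e bs) (flip₂-injective b) (flips-injective e bs)

flips-cancel : ∀ e (bs bs′ : Vec Bool m) → flips e bs ≗ flips e bs′ → bs ≡ bs′
flips-cancel e [] [] _ = refl
flips-cancel e (b ∷ bs) (b′ ∷ bs′) eq = cong₂ _∷_
  (flip₂-cancel b b′ (⊕-cancelˡ {f = flip₂ b} {flip₂ b′} {flips e bs} {flips e bs′} eq))
  (flips-cancel e bs bs′ (⊕-cancelʳ {f = flip₂ b} {flip₂ b′} {flips e bs} {flips e bs′} eq))

dist-flips-replicate : ∀ e m b → dist (flips e (replicate m (not b))) (flips e (replicate m b)) ≡ m * 2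
dist-flips-replicate e zero b = dist-self {n = e} id
dist-flips-replicate e (suc m) b =
  trans (dist-⊕ (flip₂ (not b)) (flip₂ b) (flips e (replicate m (not b))) (flips e (replicate m b)))
    (cong₂ _+_ (dist-flip₂ b) (dist-flips-replicate e m b))

-- The counted letter `b` is a parameter so that one argument serves both halves of the
-- construction, which differ by exchanging the two centres.
choose : Bool → ∀ m → ℕ → List (Vec Bool m)
choose b zero zero = [] ∷ []
choose b zero (suc k) = []
choose b (suc m) zero = map (not b ∷_) (choose b m zero)
choose b (suc m) (suc k) = map (b ∷_) (choose b m k) ++ map (not b ∷_) (choose b m (suc k))

length-choose : ∀ b m k → length (choose b m k) ≡ m C k
length-choose b zero zero = refl
length-choose b zero (suc k) = refl
length-choose b (suc m) zero = trans (length-map (not b ∷_) (choose b m zero)) (length-choose b m zero)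
length-choose b (suc m) (suc k) = begin
  length (map (b ∷_) (choose b m k) ++ map (not b ∷_) (choose b m (suc k)))
    ≡⟨ length-++ (map (b ∷_) (choose b m k)) ⟩
  length (map (b ∷_) (choose b m k)) + length (map (not b ∷_) (choose b m (suc k)))
    ≡⟨ cong₂ _+_ (length-map (b ∷_) (choose b m k)) (length-map (not b ∷_) (choose b m (suc k))) ⟩
  length (choose b m k) + length (choose b m (suc k))
    ≡⟨ cong₂ _+_ (length-choose b m k) (length-choose b m (suc k)) ⟩
  m C k + m C suc k
    ≡⟨ nCk+nC[k+1]≡[n+1]C[k+1] m k ⟩
  suc m C suc k ∎
  where open ≡-Reasoning

choose-unique : ∀ b m k → Unique (choose b m k)
choose-unique b zero zero = [] ∷ []
choose-unique b zero (suc k) = []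
choose-unique b (suc m) zero = Unique.map⁺ (proj₂ ∘ ∷-injective) (choose-unique b m zero)
choose-unique b (suc m) (suc k) = Unique.++⁺
  (Unique.map⁺ (proj₂ ∘ ∷-injective) (choose-unique b m k))
  (Unique.map⁺ (proj₂ ∘ ∷-injective) (choose-unique b m (suc k)))
  λ (x∈ , x∈′) → case ∈-map⁻ (b ∷_) x∈ , ∈-map⁻ (not b ∷_) x∈′ of λ where
    ((_ , _ , eq) , (_ , _ , eq′)) → not-¬ refl (proj₁ (∷-injective (trans (sym eq) eq′)))

module _ (e : ℕ) where

  private
    dist-rest : ∀ {m} b (bs cs : Vec Bool m) →
      dist (flips e (b ∷ bs)) (flips e (b ∷ cs)) ≡ dist (flips e bs) (flips e cs)
    dist-rest b bs cs = trans (dist-⊕ (flip₂ b) (flip₂ b) (flips e bs) (flips e cs))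
      (cong (_+ dist (flips e bs) (flips e cs)) (dist-self (flip₂ b)))

    dist-flip : ∀ {m} b (bs cs : Vec Bool m) →
      dist (flips e (not b ∷ bs)) (flips e (b ∷ cs)) ≡ 2 + dist (flips e bs) (flips e cs)
    dist-flip b bs cs = trans (dist-⊕ (flip₂ (not b)) (flip₂ b) (flips e bs) (flips e cs))
      (cong (_+ dist (flips e bs) (flips e cs)) (dist-flip₂ b))

    dist-flip′ : ∀ {m} b (bs cs : Vec Bool m) →
      dist (flips e (b ∷ bs)) (flips e (not b ∷ cs)) ≡ 2 + dist (flips e bs) (flips e cs)
    dist-flip′ b bs cs = subst (λ b′ → dist (flips e (b′ ∷ bs)) (flips e (not b ∷ cs)) ≡ _)
      (not-involutive b) (dist-flip (not b) bs cs)

  -- Each position where two words differ costs 2. There are k such positions against the constant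
  -- word `not b` and m - k against the constant word `b`; the second count is stated additively.
  dist-choose : ∀ b m k {bs} → bs ∈ choose b m k →
    dist (flips e (replicate m (not b))) (flips e bs) ≡ k * 2 ×
    dist (flips e (replicate m b)) (flips e bs) + k * 2 ≡ m * 2
  dist-choose b zero zero (here refl) = dist-self {n = e} id , trans (+-identityʳ _) (dist-self {n = e} id)
  dist-choose b (suc m) zero bs∈ with cs , cs∈ , refl ← ∈-map⁻ (not b ∷_) bs∈
    with eq , eq′ ← dist-choose b m zero cs∈ =
    trans (dist-rest (not b) (replicate m (not b)) cs) eq ,
    trans (cong (_+ 0) (dist-flip′ b (replicate m b) cs)) (cong (2 +_) eq′)
  dist-choose b (suc m) (suc k) bs∈ with ∈-++⁻ (map (b ∷_) (choose b m k)) bs∈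
  ... | inj₁ bs∈ˡ with cs , cs∈ , refl ← ∈-map⁻ (b ∷_) bs∈ˡ
    with eq , eq′ ← dist-choose b m k cs∈ =
    trans (dist-flip b (replicate m (not b)) cs) (cong (2 +_) eq) ,
    (begin
      dist (flips e (b ∷ replicate m b)) (flips e (b ∷ cs)) + (2 + k * 2)
        ≡⟨ cong (_+ (2 + k * 2)) (dist-rest b (replicate m b) cs) ⟩
      dist (flips e (replicate m b)) (flips e cs) + (2 + k * 2)
        ≡⟨ +-comm _ (2 + k * 2) ⟩
      2 + (k * 2 + dist (flips e (replicate m b)) (flips e cs))
        ≡⟨ cong (2 +_) (trans (+-comm (k * 2) _) eq′) ⟩
      2 + m * 2 ∎)
    where open ≡-Reasoning
  ... | inj₂ bs∈ʳ with cs , cs∈ , refl ← ∈-map⁻ (not b ∷_) bs∈ʳ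
    with eq , eq′ ← dist-choose b m (suc k) cs∈ =
    trans (dist-rest (not b) (replicate m (not b)) cs) eq ,
    trans (cong (_+ suc k * 2) (dist-flip′ b (replicate m b) cs)) (cong (2 +_) eq′)

-- Arcs of a long cycle

-- The cycle (s s+1 … s+k) of ℤ/ℓ: the identity for k = 0 and the full rotation for k = ℓ − 1.
arc : ∀ ℓ .{{_ : NonZero ℓ}} → ℕ → ℕ → Vec (Fin ℓ) ℓ
-- `offset` is i - s modulo ℓ; ℓ ∸ s is added so that the subtraction of s does not truncate.
arc ℓ s k = Vec.tabulate λ i → let offset = (toℕ i + (ℓ ∸ s)) % ℓ in
  if offset <ᵇ k then suc (toℕ i) mod ℓ else if offset ≡ᵇ k then s mod ℓ else i

module Blocks (δ : ℕ) where

  ℓ : ℕ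
  ℓ = 5 + 2 * δ

  rotation : Bool → Vec (Fin ℓ) ℓ
  rotation b = arc ℓ 0 (if b then 4 + 2 * δ else 0)

  -- An arc with parameter k moves k + 1 points and agrees with the full rotation at k points. Hence
  -- these arcs are at distance 2 + δ from `rotation (not b)` and 4 + δ from `rotation b`.
  arcs : Bool → List (Vec (Fin ℓ) ℓ)
  arcs b = map (λ s → arc ℓ s (if b then 1 + δ else 3 + δ)) (upTo ℓ)

  blocks : List (Vec (Fin ℓ) ℓ)
  blocks = (rotation false ∷ arcs true) ++ (rotation true ∷ arcs false)

  -- These facts are required only for δ = 0 and δ = 1, that is, on 5 and 7 points, where evaluation
  -- decides them. The record lets the later argument treat both values at once.
  record Valid : Set where
    field
      blocks-perm : All (Unique ∘ toList) blocks
      blocks-unique : Unique blocks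
      rotation-dist : ∀ b → hamming (rotation b) (rotation (not b)) ≡ ℓ
      arcs-dist : ∀ b → All (λ v → hamming (rotation (not b)) v ≡ 2 + δ × hamming (rotation b) v ≡ 4 + δ) (arcs b)

  valid? : Dec (All (Unique ∘ toList) blocks × Unique blocks)
  valid? = All.all? (λ v → DecUnique.unique? _≟_ (toList v)) blocks ×-dec DecUnique.unique? (≡-dec _≟_) blocks

  arcs-dist? : ∀ b → Dec (All (λ v → hamming (rotation (not b)) v ≡ 2 + δ × hamming (rotation b) v ≡ 4 + δ) (arcs b))
  arcs-dist? b = All.all? (λ v → (hamming (rotation (not b)) v ≟ℕ 2 + δ) ×-dec (hamming (rotation b) v ≟ℕ 4 + δ)) (arcs b)

valid₀ : Blocks.Valid 0
valid₀ = record
  { blocks-perm = proj₁ (from-yes valid?)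
  ; blocks-unique = proj₂ (from-yes valid?)
  ; rotation-dist = λ { false → refl ; true → refl }
  ; arcs-dist = λ { false → from-yes (arcs-dist? false) ; true → from-yes (arcs-dist? true) } }
  where open Blocks 0

valid₁ : Blocks.Valid 1
valid₁ = record
  { blocks-perm = proj₁ (from-yes valid?)
  ; blocks-unique = proj₂ (from-yes valid?)
  ; rotation-dist = λ { false → refl ; true → refl }
  ; arcs-dist = λ { false → from-yes (arcs-dist? false) ; true → from-yes (arcs-dist? true) } }
  where open Blocks 1

-- The common ball of (ℓ-cycle) ⊕ (2t − 3 transpositions) and the identity

-- Pascal's rule gives two terms, which are equal by symmetry because u and u + 1 add up to the odd
-- number 2u + 1.
central-binomial : ∀ u → suc (suc (2 * u)) C suc u ≡ 2 * (suc (2 * u) C suc u)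
central-binomial u = begin
  suc q C suc u            ≡⟨ nCk+nC[k+1]≡[n+1]C[k+1] q u ⟨
  q C u + q C suc u        ≡⟨ cong (_+ q C suc u) (nCk≡nC[n∸k] u≤q) ⟩
  q C (q ∸ u) + q C suc u  ≡⟨ cong (λ k → q C k + q C suc u) q∸u≡1+u ⟩
  q C suc u + q C suc u    ≡⟨ cong (q C suc u +_) (+-identityʳ _) ⟨
  2 * (q C suc u)          ∎
  where
  open ≡-Reasoning
  q = suc (2 * u)
  u≤q : u ≤ q
  u≤q = ≤-trans (m≤m+n u (u + 0)) (n≤1+n _)
  q∸u≡1+u : q ∸ u ≡ suc u
  q∸u≡1+u = trans (cong (_∸ u) (cong (λ w → suc (u + w)) (+-identityʳ u))) (m+n∸n≡m (suc u) u)

module LowerBound (δ : ℕ) (δ≤1 : δ ≤ 1) (valid : Blocks.Valid δ) (u e : ℕ) where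

  open Blocks δ
  open Valid valid
  open +-*-Solver

  private
    t q r size : ℕ
    t = 2 + u
    -- This is 2t - 3 without truncated subtraction. Since ℓ + 2q = 2r - 1, `e` is the excess of n
    -- over 2r - 1.
    q = suc (2 * u)
    r = 2 * t + δ
    size = ℓ + (q * 2 + e)

  Word : Set
  Word = Vec (Fin ℓ) ℓ × Vec Bool q

  perm : Word → Vec (Fin size) size
  perm (v , bs) = Vec.tabulate (lookup v ⊕ flips e bs)

  endpoint : Bool → Vec (Fin size) size
  endpoint b = perm (rotation b , replicate q b)

  -- An entry (v , b , k) stands for the words (v , bs) with exactly k letters b in bs.
  Entry : Set
  Entry = Vec (Fin ℓ) ℓ × Bool × ℕ

  -- These words lie on the side of `endpoint (not b)`: their second component departs from its
  -- constant word in t or t - 1 letters.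
  entries : Bool → List Entry
  entries b = (rotation (not b) , b , t) ∷ map (λ v → v , b , suc u) (arcs b)

  words : Entry → List Word
  words (v , b , k) = map (v ,_) (choose b q k)

  allWords : List Word
  allWords = concatMap words (entries true ++ entries false)

  -- The two ball conditions, for the centres `endpoint (not b)` and `endpoint b`. The second has 2k
  -- added on both sides, to match the additive form in `dist-choose`.
  Fits : Entry → Set
  Fits (v , b , k) = hamming (rotation (not b)) v + k * 2 ≤ r × hamming (rotation b) v + q * 2 ≤ r + k * 2

  entries-fit : ∀ b → All Fits (entries b)
  entries-fit b = (fit₁ , fit₂) ∷ All.map⁺ (All.map (λ (eq , eq′) → fit₃ eq , fit₄ eq′) (arcs-dist b))
    where
    open ≤-Reasoning
    self : hamming (rotation (not b)) (rotation (not b)) ≡ 0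
    self = trans (hamming≡dist (rotation (not b)) (rotation (not b))) (dist-self (lookup (rotation (not b))))
    fit₁ : hamming (rotation (not b)) (rotation (not b)) + t * 2 ≤ r
    fit₁ = begin
      hamming (rotation (not b)) (rotation (not b)) + t * 2  ≡⟨ cong₂ _+_ self (*-comm t 2) ⟩
      2 * t                                                  ≤⟨ m≤m+n _ δ ⟩
      r                                                      ∎
    fit₂ : hamming (rotation b) (rotation (not b)) + q * 2 ≤ r + t * 2
    fit₂ = begin
      hamming (rotation b) (rotation (not b)) + q * 2  ≡⟨ cong (_+ q * 2) (rotation-dist b) ⟩
      ℓ + q * 2                                        ≡⟨ solve 2 (λ δ u →
        (con 5 :+ con 2 :* δ) :+ (con 1 :+ con 2 :* u) :* con 2 := (con 7 :+ con 4 :* u :+ δ) :+ δ) refl δ u ⟩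
      -- The slack here is 1 - δ, which is where δ ≤ 1 enters. The estimates for arcs below are
      -- equalities.
      7 + 4 * u + δ + δ                                ≤⟨ +-monoʳ-≤ (7 + 4 * u + δ) δ≤1 ⟩
      7 + 4 * u + δ + 1                                ≡⟨ solve 2 (λ δ u →
        (con 7 :+ con 4 :* u :+ δ) :+ con 1 := (con 2 :* (con 2 :+ u) :+ δ) :+ (con 2 :+ u) :* con 2) refl δ u ⟩
      r + t * 2                                        ∎
    fit₃ : ∀ {h} → h ≡ 2 + δ → h + suc u * 2 ≤ r
    fit₃ refl = ≤-reflexive (solve 2 (λ δ u →
      (con 2 :+ δ) :+ (con 1 :+ u) :* con 2 := con 2 :* (con 2 :+ u) :+ δ) refl δ u)
    fit₄ : ∀ {h} → h ≡ 4 + δ → h + q * 2 ≤ r + suc u * 2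
    fit₄ refl = ≤-reflexive (solve 2 (λ δ u →
      (con 4 :+ δ) :+ (con 1 :+ con 2 :* u) :* con 2 := (con 2 :* (con 2 :+ u) :+ δ) :+ (con 1 :+ u) :* con 2) refl δ u)

  entries-blocks : map proj₁ (entries true ++ entries false) ≡ blocks
  entries-blocks = trans (map-++ proj₁ (entries true) (entries false))
    (cong₂ (λ vs ws → (rotation false ∷ vs) ++ (rotation true ∷ ws)) (strip true) (strip false))
    where
    strip : ∀ b → map proj₁ (map (λ v → v , b , suc u) (arcs b)) ≡ arcs b
    strip b = trans (sym (map-∘ (arcs b))) (map-id (arcs b))

  ∈-allWords⁻ : ∀ {v bs} (es : List Entry) → (v , bs) ∈ concatMap words es →
    ∃ λ b → ∃ λ k → (v , b , k) ∈ es × bs ∈ choose b q k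
  ∈-allWords⁻ ((v , b , k) ∷ es) w∈ with ∈-++⁻ (words (v , b , k)) w∈
  ... | inj₁ w∈ˡ with _ , bs∈ , refl ← ∈-map⁻ (v ,_) w∈ˡ = b , k , here refl , bs∈
  ... | inj₂ w∈ʳ with b′ , k′ , e∈ , bs∈ ← ∈-allWords⁻ es w∈ʳ = b′ , k′ , there e∈ , bs∈

  -- Words from different entries already differ in their block on the ℓ-cycle, since `blocks` has
  -- no repetition.
  allWords-unique : Unique allWords
  allWords-unique = go (entries true ++ entries false) (subst Unique (sym entries-blocks) blocks-unique)
    where
    go : ∀ es → Unique (map proj₁ es) → Unique (concatMap words es)
    go [] _ = []
    go ((v , b , k) ∷ es) (v∉ ∷ u-es) = Unique.++⁺
      (Unique.map⁺ (cong proj₂) (choose-unique b q k)) (go es u-es)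
      λ { {w} (w∈ , w∈′) → case ∈-map⁻ (v ,_) w∈ , ∈-allWords⁻ es w∈′ of λ where
        ((_ , _ , refl) , (_ , _ , e∈ , _)) → All.lookup v∉ (∈-map⁺ proj₁ e∈) refl }

  length-allWords : length allWords ≡ 2 * (q C t) + ℓ * (suc q C suc u)
  length-allWords = begin
    length allWords
      ≡⟨ cong length (concatMap-++ words (entries true) (entries false)) ⟩
    length (concatMap words (entries true) ++ concatMap words (entries false))
      ≡⟨ length-++ (concatMap words (entries true)) ⟩
    length (concatMap words (entries true)) + length (concatMap words (entries false))
      ≡⟨ cong₂ _+_ (half true) (half false) ⟩
    (q C t + ℓ * (q C suc u)) + (q C t + ℓ * (q C suc u))
      ≡⟨ solve 3 (λ x l y → (x :+ l :* y) :+ (x :+ l :* y) := con 2 :* x :+ l :* (con 2 :* y)) refl (q C t) ℓ (q C suc u) ⟩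
    2 * (q C t) + ℓ * (2 * (q C suc u))
      ≡⟨ cong (λ x → 2 * (q C t) + ℓ * x) (central-binomial u) ⟨
    2 * (q C t) + ℓ * (suc q C suc u) ∎
    where
    open ≡-Reasoning
    length-words : ∀ v b k → length (words (v , b , k)) ≡ q C k
    length-words v b k = trans (length-map (v ,_) (choose b q k)) (length-choose b q k)
    uniform : ∀ b k vs → length (concatMap words (map (λ v → v , b , k) vs)) ≡ length vs * (q C k)
    uniform b k [] = refl
    uniform b k (v ∷ vs) = trans (length-++ (words (v , b , k))) (cong₂ _+_ (length-words v b k) (uniform b k vs))
    half : ∀ b → length (concatMap words (entries b)) ≡ q C t + ℓ * (q C suc u)
    half b = trans (length-++ (words (rotation (not b) , b , t))) (cong₂ _+_ (length-words _ b t)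
      -- There is one arc for each of the ℓ starting points.
      (trans (uniform b (suc u) (arcs b)) (cong (_* (q C suc u)) (trans (length-map _ (upTo ℓ)) (length-upTo ℓ)))))

  dist-perm : ∀ v bs w cs → dist (lookup (perm (v , bs))) (lookup (perm (w , cs)))
    ≡ hamming v w + dist (flips e bs) (flips e cs)
  dist-perm v bs w cs = trans (dist-cong (lookup∘tabulate (lookup v ⊕ flips e bs)) (lookup∘tabulate (lookup w ⊕ flips e cs)))
    (trans (dist-⊕ (lookup v) (lookup w) (flips e bs) (flips e cs))
      (cong (_+ dist (flips e bs) (flips e cs)) (sym (hamming≡dist v w))))

  perm-isPerm : ∀ {v} bs → v ∈ blocks → IsPerm (perm (v , bs))
  perm-isPerm {v} bs v∈ = tabulate-isPerm (⊕-injective (lookup v) (flips e bs)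
    (unique⇒isPerm v (All.lookup blocks-perm v∈)) (flips-injective e bs))

  perm-injective : ∀ {w w′} → perm w ≡ perm w′ → w ≡ w′
  perm-injective {v , bs} {v′ , bs′} eq = cong₂ _,_
    (lookup-cong⇒≡ (⊕-cancelˡ {f = lookup v} {lookup v′} {flips e bs} {flips e bs′} pointwise))
    (flips-cancel e bs bs′ (⊕-cancelʳ {f = lookup v} {lookup v′} {flips e bs} {flips e bs′} pointwise))
    where
    pointwise : lookup v ⊕ flips e bs ≗ lookup v′ ⊕ flips e bs′
    pointwise i = trans (sym (lookup∘tabulate (lookup v ⊕ flips e bs) i))
      (trans (cong (λ w → lookup w i) eq) (lookup∘tabulate (lookup v′ ⊕ flips e bs′) i))

  near-endpoints : ∀ {v b k bs} → Fits (v , b , k) → bs ∈ choose b q k →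
    dist (lookup (endpoint (not b))) (lookup (perm (v , bs))) ≤ r ×
    dist (lookup (endpoint b)) (lookup (perm (v , bs))) ≤ r
  near-endpoints {v} {b} {k} {bs} (fit , fit′) bs∈ with near , far ← dist-choose e b q k bs∈ =
    (begin
      dist (lookup (endpoint (not b))) (lookup (perm (v , bs)))  ≡⟨ dist-perm (rotation (not b)) (replicate q (not b)) v bs ⟩
      hamming (rotation (not b)) v + dist (flips e (replicate q (not b))) (flips e bs) ≡⟨ cong (hamming (rotation (not b)) v +_) near ⟩
      hamming (rotation (not b)) v + k * 2                       ≤⟨ fit ⟩
      r                                                          ∎) ,
    +-cancelʳ-≤ (k * 2) _ _ (begin
      dist (lookup (endpoint b)) (lookup (perm (v , bs))) + k * 2  ≡⟨ cong (_+ k * 2) (dist-perm (rotation b) (replicate q b) v bs) ⟩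
      hamming (rotation b) v + dist (flips e (replicate q b)) (flips e bs) + k * 2 ≡⟨ +-assoc (hamming (rotation b) v) _ _ ⟩
      hamming (rotation b) v + (dist (flips e (replicate q b)) (flips e bs) + k * 2) ≡⟨ cong (hamming (rotation b) v +_) far ⟩
      hamming (rotation b) v + q * 2                               ≤⟨ fit′ ⟩
      r + k * 2                                                    ∎)
    where open ≤-Reasoning

  near-both : ∀ {v k bs} b → Fits (v , b , k) → bs ∈ choose b q k →
    dist (lookup (endpoint false)) (lookup (perm (v , bs))) ≤ r ×
    dist (lookup (endpoint true)) (lookup (perm (v , bs))) ≤ r
  near-both {v} {k} {bs} false fits bs∈ = swap (near-endpoints {v} {false} {k} {bs} fits bs∈)
  near-both {v} {k} {bs} true fits bs∈ = near-endpoints {v} {true} {k} {bs} fits bs∈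

  perm-∈ : ∀ w → w ∈ allWords → perm w ∈ commonBall size r (endpoint false) (endpoint true)
  perm-∈ (v , bs) w∈ =
    let b , k , e∈ , bs∈ = ∈-allWords⁻ (entries true ++ entries false) w∈
        fits = All.lookup (All.++⁺ (entries-fit true) (entries-fit false)) e∈
        near₀ , near₁ = near-both {v} {k} {bs} b fits bs∈
    in ∈-commonBall⁺ size r (endpoint false) (endpoint true) {perm (v , bs)}
         (perm-isPerm {v} bs (subst (v ∈_) entries-blocks (∈-map⁺ proj₁ e∈))) near₀ near₁

  lower-bound : 2 * (q C t) + ℓ * (suc q C suc u) ≤ I size (2 * r ∸ 1) r
  lower-bound = begin
    2 * (q C t) + ℓ * (suc q C suc u)                  ≡⟨ length-allWords ⟨
    length allWords                                    ≤⟨ injectiveOn⇒length≤ perm allWords-unique (λ {w} → perm-∈ w) (λ _ _ → perm-injective) ⟩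
    ballInter size r (endpoint false) (endpoint true)  ≤⟨ I-upper (endpoint false) (endpoint true)
      (perm-isPerm (replicate q false) (here refl))
      (perm-isPerm (replicate q true) (∈-++⁺ʳ (rotation false ∷ arcs true) (here refl))) endpoints-dist ⟩
    I size (2 * r ∸ 1) r                               ∎
    where
    open ≤-Reasoning
    endpoints-dist : dist (lookup (endpoint false)) (lookup (endpoint true)) ≡ 2 * r ∸ 1
    endpoints-dist = trans (dist-perm (rotation false) (replicate q false) (rotation true) (replicate q true))
      (trans (cong₂ _+_ (rotation-dist false) (dist-flips-replicate e q true)) size≡)
      where
      size≡ : ℓ + q * 2 ≡ 2 * r ∸ 1
      size≡ = cong (_∸ 1) (solve 2 (λ δ u → con 1 :+ ((con 5 :+ con 2 :* δ) :+ (con 1 :+ con 2 :* u) :* con 2)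
        := con 2 :* (con 2 :* (con 2 :+ u) :+ δ)) refl δ u)

  lower-bound-at : ∀ n → size ≡ n → 2 * (q C t) + ℓ * (suc q C suc u) ≤ I n (2 * r ∸ 1) r
  lower-bound-at n refl = lower-bound

-- Passage to arbitrary n and assembly of the three claims

I-lower-bound : ∀ δ → δ ≤ 1 → Blocks.Valid δ → ∀ u n → let t = 2 + u; r = 2 * t + δ in 2 * r ∸ 1 ≤ n →
  2 * ((2 * t ∸ 3) C t) + (5 + 2 * δ) * ((2 * t ∸ 2) C (t ∸ 1)) ≤ I n (2 * r ∸ 1) r
I-lower-bound δ δ≤1 valid u n 2r-1≤n = let e , e≡ = m≤n⇒∃[o]m+o≡n 2r-1≤n in
  ≤-trans (≤-reflexive bound≡) (LowerBound.lower-bound-at δ δ≤1 valid u e n (trans (size≡ e) e≡))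
  where
  open +-*-Solver
  t r : ℕ
  t = 2 + u
  r = 2 * t + δ
  bound≡ : 2 * ((2 * t ∸ 3) C t) + (5 + 2 * δ) * ((2 * t ∸ 2) C (t ∸ 1))
    ≡ 2 * (suc (2 * u) C t) + (5 + 2 * δ) * (suc (suc (2 * u)) C suc u)
  -- Once 2t is written as 4 + 2u, the subtractions of 3 and 2 compute.
  bound≡ = cong (λ s → 2 * ((s ∸ 3) C t) + (5 + 2 * δ) * ((s ∸ 2) C suc u))
    (solve 1 (λ u → con 2 :* (con 2 :+ u) := con 4 :+ con 2 :* u) refl u)
  size≡ : ∀ e → 5 + 2 * δ + (suc (2 * u) * 2 + e) ≡ 2 * r ∸ 1 + e
  size≡ e = trans (sym (+-assoc (5 + 2 * δ) (suc (2 * u) * 2) e)) (cong (λ s → s ∸ 1 + e)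
    (solve 2 (λ δ u → con 1 :+ ((con 5 :+ con 2 :* δ) :+ (con 1 :+ con 2 :* u) :* con 2)
        := con 2 :* (con 2 :* (con 2 :+ u) :+ δ)) refl δ u))

theorem2 : (t r ℓ : ℕ) → 2 ≤ t →
    ((r ≡ 2 * t × ℓ ≡ 5) ⊎ (r ≡ 2 * t + 1 × ℓ ≡ 7)) →
    ((n : ℕ) → 2 * r ∸ 1 ≤ n →
    2 * ((2 * t ∸ 3) C t) + ℓ * ((2 * t ∸ 2) C (t ∸ 1)) ≤ I n (2 * r ∸ 1) r)
    × ((n : ℕ) → 2 * r ≤ n →
    (N n (2 * r ∸ 1) r ≡ I n (2 * r ∸ 1) r) × (N n (2 * r) r ≤ I n (2 * r ∸ 1) r))
    × ((n : ℕ) → 2 * r ≤ n →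
    2 * ((2 * t ∸ 3) C t) + ℓ * ((2 * t ∸ 2) C (t ∸ 1)) ≤ N n (2 * r ∸ 1) r)
theorem2 (suc zero) _ _ (s≤s ())
theorem2 t@(suc (suc u)) r ℓ 2≤t case = lower case , (λ n _ → N≡I n 1<r , N-2r≤I n 1<r) ,
  λ n 2r≤n → ≤-trans (lower case n (≤-trans (m∸n≤m (2 * r) 1) 2r≤n)) (I≤N n (2 * r ∸ 1) r)
  where
  bound : ℕ → ℕ
  bound ℓ = 2 * ((2 * t ∸ 3) C t) + ℓ * ((2 * t ∸ 2) C (t ∸ 1))
  lower : (r ≡ 2 * t × ℓ ≡ 5) ⊎ (r ≡ 2 * t + 1 × ℓ ≡ 7) → ∀ n → 2 * r ∸ 1 ≤ n → bound ℓ ≤ I n (2 * r ∸ 1) r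
  -- For δ = 0 the radius appears as 2t + 0 and has to be transported to 2t; for δ = 1 both 2t + 1
  -- and ℓ = 7 match by computation.
  lower (inj₁ (refl , refl)) = subst (λ r → ∀ n → 2 * r ∸ 1 ≤ n → bound 5 ≤ I n (2 * r ∸ 1) r)
    (+-identityʳ (2 * t)) (I-lower-bound 0 z≤n valid₀ u)
  lower (inj₂ (refl , refl)) = I-lower-bound 1 ≤-refl valid₁ u
  2t≤r : (r ≡ 2 * t × ℓ ≡ 5) ⊎ (r ≡ 2 * t + 1 × ℓ ≡ 7) → 2 * t ≤ r
  2t≤r (inj₁ (refl , _)) = ≤-refl
  2t≤r (inj₂ (refl , _)) = m≤m+n (2 * t) 1
  1<r : 1 < r
  1<r = ≤-trans 2≤t (≤-trans (m≤m+n t (t + 0)) (2t≤r case))
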